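{- Let $1\le k\le n$ be integers, $\delta\in(0,1)$, and let $\xi$ be an integer with $\xi\ge\frac{2(k+1)!}{\delta^2}\ln n$. Let $S$ be a multiset of $\xi$ permutations of $[n]$, each drawn independently and uniformly at random. Then with probability at least $1-\frac1n$, the uniform distribution over $S$ satisfies the $(k,\delta)$-uniform-induced-ordering property.
   Context: $(k,\delta)$-uniform-induced-ordering property of a distribution over permutations $\pi$ of $[n]$ (where $\pi(i)$ is the position of item $i$): for every $k$ distinct items $y_1,\dots,y_k\in[n]$, $\Pr[\pi(y_1)<\dots<\pi(y_k)]\ge(1-\delta)/k!$.
   Formalization: The parameter δ in (0,1) is taken to be a rational number p/q instead of an arbitrary real number. -}

module Defs where

open import Data.Bool using (Bool; true; false; _∧_; not)
open import Data.Nat using (ℕ; zero; suc; _+_; _*_; _<ᵇ_; _^_)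
open import Data.Fin using (Fin; toℕ)
open import Data.Fin.Properties using (_≟_)
open import Data.List using (List; []; _∷_; filterᵇ; length; allFin; concatMap; map)
open import Data.Bool.ListAction using (all; any)
open import Data.Vec using (Vec; []; _∷_; lookup; toList)
open import Relation.Nullary.Decidable using (⌊_⌋)

allVecs : ∀ {A : Set} (m : ℕ) → List A → List (Vec A m)
allVecs zero    xs = [] ∷ []
allVecs (suc m) xs = concatMap (λ x → map (x ∷_) (allVecs m xs)) xs

distinctᵇ : ∀ {n} → List (Fin n) → Bool
distinctᵇ []       = true
distinctᵇ (x ∷ xs) = not (any (λ y → ⌊ x ≟ y ⌋) xs) ∧ distinctᵇ xs

-- A permutation of [n] is represented by π : Vec (Fin n) n with pairwise distinct
-- entries; lookup π i = π(i) is the position of item i.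
Perm : ℕ → Set
Perm n = Vec (Fin n) n

perms : (n : ℕ) → List (Perm n)
perms n = filterᵇ (λ v → distinctᵇ (toList v)) (allVecs n (allFin n))

distinctTuples : (n k : ℕ) → List (Vec (Fin n) k)
distinctTuples n k = filterᵇ (λ v → distinctᵇ (toList v)) (allVecs k (allFin n))

increasingᵇ : ∀ {n} → List (Fin n) → Bool
increasingᵇ []           = true
increasingᵇ (x ∷ [])     = true
increasingᵇ (x ∷ y ∷ xs) = (toℕ x <ᵇ toℕ y) ∧ increasingᵇ (y ∷ xs)

inducesOrderᵇ : ∀ {n k} → Perm n → Vec (Fin n) k → Bool
inducesOrderᵇ π ys = increasingᵇ (map (lookup π) (toList ys))

factorial : ℕ → ℕ
factorial zero    = 1
factorial (suc m) = suc m * factorial m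

-- (k,δ)-uniform-induced-ordering property of the uniform distribution over the
-- multiset S = {π_1,…,π_ξ}, with δ = p/q:
-- for every k distinct items y, #{i : π_i(y_1)<…<π_i(y_k)} / ξ ≥ (1 - p/q)/k!,
-- i.e. (cleared of denominators) #{…} * k! * q ≥ (q - p) * ξ  (here p < q).
uioᵇ : ∀ {n ξ} (k p q : ℕ) → Vec (Perm n) ξ → Bool
uioᵇ {n} {ξ} k p q S =
  all (λ ys → ⌊ Data.Nat._≤?_ ((q Data.Nat.∸ p) * ξ)
                              (length (filterᵇ (λ π → inducesOrderᵇ π ys) (toList S)) * factorial k * q) ⌋)
      (distinctTuples n k)

goodSamples : (n k p q ξ : ℕ) → ℕ
goodSamples n k p q ξ = length (filterᵇ (uioᵇ k p q) (allVecs ξ (perms n)))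

allSamples : (n ξ : ℕ) → ℕ
allSamples n ξ = length (allVecs ξ (perms n))

-- expScaled A N = N! * Σ_{j=0}^{N} A^j / j!   (a natural number).
expScaled : ℕ → ℕ → ℕ
expScaled A zero    = 1
expScaled A (suc N) = suc N * expScaled A N + A ^ suc N

-- For natural A, B with B ≥ 1:  ln m ≤ A / B  ⇔  m^B ≤ e^A  ⇔
-- ∃ N, m^B ≤ Σ_{j≤N} A^j/j!  (partial sums increase to e^A, and e^A is never an
-- integer for A ≥ 1, while for A = 0 the N = 0 partial sum equals e^0 = 1).
LnLeq : (m A B : ℕ) → Set
LnLeq m A B = Data.Product.∃ λ N → m ^ B * factorial N Data.Nat.≤ expScaled A N
  where import Data.Product

{-# OPTIONS --safe #-}
module Submission where

-- Relabelling items by adjacent transpositions shows that inserting a new item into an ordered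
-- tuple is equally likely to succeed at every place, so every distinct k-tuple is ordered by at
-- least a 1/k! fraction of all permutations. Chernoff's method with success weight
-- t = 1 − δ + δ²/2 in place of e^(−δ) bounds the fraction of bad samples for one tuple by
-- (1 − (1−t)/k!)^ξ t^(−x), where x = ⌊(1−δ)ξ/k!⌋. From 1/t ≤ 1 + δ + δ²/2 ≤ e^δ and
-- 1 − y ≤ e^(−y) this is at most e^(−δ²ξ/(2k!)) ≤ n^(−(k+1)), and a union bound over the at most
-- n^k tuples finishes. The exponential enters only through partial sums of its series.

open import Defs
open import Data.Bool using (Bool; true; false; not; T; if_then_else_; _∧_)
open import Data.Bool.ListAction using (all; any)
open import Data.Bool.Properties using (T?; T-∧)
open import Data.Fin using (Fin; toℕ)
open import Data.Fin.Permutation.Components using (transpose; transpose-inverse)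
import Data.Fin.Properties as Fin
open import Data.List using (List; []; _∷_; [_]; _++_; filterᵇ; length; allFin; concatMap; map; cartesianProductWith)
open import Data.List.Membership.Propositional using (_∈_)
open import Data.List.Membership.Propositional.Properties
  using (∈-filter⁺; ∈-filter⁻; ∈-cartesianProductWith⁺; ∈-allFin; ∈-∃++; ∈-++⁻; ∈-++⁺ˡ; ∈-++⁺ʳ; ∈-map⁻)
open import Data.List.Properties
  using (map-id-local; map-++; map-cong; map-∘; length-map; length-tabulate; length-filter; length-++-sucʳ; ++-assoc)
open import Data.List.Relation.Binary.Permutation.Propositional using (_↭_; swap; ↭-refl; ↭⇒↭ₛ)
open import Data.List.Relation.Binary.Permutation.Propositional.Properties using (++⁺ˡ)
import Data.List.Relation.Binary.Permutation.Setoid.Properties as Permₛ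
open import Data.List.Relation.Binary.Subset.Propositional using (_⊆_)
open import Data.List.Relation.Unary.All as All using (All; []; _∷_)
import Data.List.Relation.Unary.All.Properties as All
open import Data.List.Relation.Unary.AllPairs using ([]; _∷_)
open import Data.List.Relation.Unary.Any as Any using (Any; here; there)
import Data.List.Relation.Unary.Any.Properties as Any
open import Data.List.Relation.Unary.Unique.Propositional using (Unique)
import Data.List.Relation.Unary.Unique.Propositional.Properties as Unique
open import Data.Nat
open import Data.Nat.DivMod using (m/n*n≤m; m*n/n≡m; /-monoˡ-≤)
open import Data.Nat.ListAction using (sum; product)
open import Data.Nat.ListAction.Properties using (sum-++)
open import Data.Nat.Properties
open import Data.Nat.Tactic.RingSolver using (solve-∀)
open import Data.Product using (∃; _,_; _×_; proj₂)
open import Data.Sum using (inj₁; inj₂)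
open import Data.Vec as Vec using (Vec; []; _∷_; lookup; toList)
import Data.Vec.Properties as Vec
import Data.Vec.Relation.Unary.All.Properties as VecAll
import Data.Vec.Relation.Unary.AllPairs as VecAllPairs
import Data.Vec.Relation.Unary.Unique.Propositional as VecUnique
import Data.Vec.Relation.Unary.Unique.Propositional.Properties as VecUnique
open import Function using (_∘_; id; Equivalence)
open import Relation.Binary.Definitions using (tri<; tri≈; tri>)
open import Relation.Binary.PropositionalEquality hiding ([_])
open import Relation.Nullary using (contradiction; yes; no)
open import Relation.Nullary.Decidable using (⌊_⌋; dec-true; dec-false)

-- Partial sums of the exponential series

factorial≢0 : ∀ m → NonZero (factorial m)
factorial≢0 zero    = _
factorial≢0 (suc m) = m*n≢0 (suc m) (factorial m) {{_}} {{factorial≢0 m}}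

^-distribʳ-* : ∀ m n o → (n * o) ^ m ≡ n ^ m * o ^ m
^-distribʳ-* zero    n o = refl
^-distribʳ-* (suc m) n o = trans (cong (n * o *_) (^-distribʳ-* m n o)) (eq n o (n ^ m) (o ^ m))
  where
  eq : ∀ n o x y → n * o * (x * y) ≡ n * x * (o * y)
  eq = solve-∀

-- The convexity estimate b^m - a^m ≤ m (b - a) b^(m-1) with `b = a + u`, free of subtraction. It is
-- applied to each term of the series in `expTrunc-convex`.
^-+-≤ : ∀ a u n → (a + u) ^ suc n ≤ a ^ suc n + suc n * u * (a + u) ^ n
^-+-≤ a u zero = ≤-reflexive (eq a u)
  where
  eq : ∀ a u → (a + u) * 1 ≡ a * 1 + 1 * u * 1
  eq = solve-∀
^-+-≤ a u (suc n) = begin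
  (a + u) * (a + u) ^ suc n
    ≤⟨ *-monoʳ-≤ (a + u) (^-+-≤ a u n) ⟩
  (a + u) * (a ^ suc n + suc n * u * (a + u) ^ n)
    ≡⟨ expand a u (suc n) (a ^ suc n) ((a + u) ^ n) ⟩
  a * a ^ suc n + suc n * u * ((a + u) * (a + u) ^ n) + u * a ^ suc n
    ≤⟨ +-monoʳ-≤ _ (*-monoʳ-≤ u (^-monoˡ-≤ (suc n) (m≤m+n a u))) ⟩
  a * a ^ suc n + suc n * u * ((a + u) * (a + u) ^ n) + u * (a + u) ^ suc n
    ≡⟨ collect u (suc n) (a * a ^ suc n) ((a + u) ^ suc n) ⟩
  a ^ suc (suc n) + suc (suc n) * u * (a + u) ^ suc n ∎
  where
  open ≤-Reasoning
  expand : ∀ a u m x y → (a + u) * (x + m * u * y) ≡ a * x + m * u * ((a + u) * y) + u * x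
  expand = solve-∀
  collect : ∀ u m x y → x + m * u * y + u * y ≡ x + suc m * u * y
  collect = solve-∀

-- The binomial expansion cut after the d² term, doubled so that the coefficient (j+2)(j+1)/2 needs
-- no division. The induction multiplies by `a + d` and discards the d³ term that appears.
binomial-two-terms : ∀ a d j →
  2 * a ^ suc (suc j) + 2 * suc (suc j) * d * a ^ suc j + suc (suc j) * suc j * (d * d) * a ^ j
    ≤ 2 * (a + d) ^ suc (suc j)
binomial-two-terms a d zero = ≤-reflexive (eq a d)
  where
  eq : ∀ a d → 2 * (a * (a * 1)) + 2 * 2 * d * (a * 1) + 2 * 1 * (d * d) * 1
             ≡ 2 * ((a + d) * ((a + d) * 1))
  eq = solve-∀
binomial-two-terms a d (suc j) = begin
  2 * (a * (a * (a * x))) + 2 * suc (suc (suc j)) * d * (a * (a * x))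
    + suc (suc (suc j)) * suc (suc j) * (d * d) * (a * x)
    -- The cubic term is put back so that the sum factors exactly through `a + d`.
    ≤⟨ m≤m+n _ _ ⟩
  2 * (a * (a * (a * x))) + 2 * suc (suc (suc j)) * d * (a * (a * x))
    + suc (suc (suc j)) * suc (suc j) * (d * d) * (a * x) + suc (suc j) * suc j * (d * d * d) * x
    ≡⟨ expand a d j x ⟨
  (a + d) * (2 * (a * (a * x)) + 2 * suc (suc j) * d * (a * x) + suc (suc j) * suc j * (d * d) * x)
    ≤⟨ *-monoʳ-≤ (a + d) (binomial-two-terms a d j) ⟩
  (a + d) * (2 * (a + d) ^ suc (suc j))
    ≡⟨ assoc (a + d) ((a + d) ^ suc (suc j)) ⟩
  2 * (a + d) ^ suc (suc (suc j)) ∎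
  where
  open ≤-Reasoning
  x = a ^ j
  expand : ∀ a d j x →
    (a + d) * (2 * (a * (a * x)) + 2 * suc (suc j) * d * (a * x) + suc (suc j) * suc j * (d * d) * x)
    ≡ 2 * (a * (a * (a * x))) + 2 * suc (suc (suc j)) * d * (a * (a * x))
      + suc (suc (suc j)) * suc (suc j) * (d * d) * (a * x) + suc (suc j) * suc j * (d * d * d) * x
  expand = solve-∀
  assoc : ∀ s y → s * (2 * y) ≡ 2 * (s * y)
  assoc = solve-∀

-- expTrunc E N a = N! · E^N · Σ_{j≤N} (a/E)^j / j!
expTrunc : ℕ → ℕ → ℕ → ℕ
expTrunc E zero    a = 1
expTrunc E (suc N) a = suc N * E * expTrunc E N a + a ^ suc N

expTrunc-zero : ∀ E N → expTrunc E N 0 ≡ factorial N * E ^ N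
expTrunc-zero E zero    = refl
expTrunc-zero E (suc N) = begin
  suc N * E * expTrunc E N 0 + 0      ≡⟨ +-identityʳ _ ⟩
  suc N * E * expTrunc E N 0          ≡⟨ cong (suc N * E *_) (expTrunc-zero E N) ⟩
  suc N * E * (factorial N * E ^ N)   ≡⟨ eq (suc N) E (factorial N) (E ^ N) ⟩
  suc N * factorial N * (E * E ^ N)   ∎
  where
  open ≡-Reasoning
  eq : ∀ n E f x → n * E * (f * x) ≡ n * f * (E * x)
  eq = solve-∀

expTrunc-integral : ∀ E N A → expTrunc E N (A * E) ≡ expScaled A N * E ^ N
expTrunc-integral E zero    A = refl
expTrunc-integral E (suc N) A = begin
  suc N * E * expTrunc E N (A * E) + (A * E) ^ suc N
    ≡⟨ cong₂ (λ x y → suc N * E * x + y) (expTrunc-integral E N A) (^-distribʳ-* (suc N) A E) ⟩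
  suc N * E * (expScaled A N * E ^ N) + A ^ suc N * E ^ suc N
    ≡⟨ eq (suc N) E (expScaled A N) (E ^ N) (A ^ suc N) ⟩
  (suc N * expScaled A N + A ^ suc N) * E ^ suc N ∎
  where
  open ≡-Reasoning
  eq : ∀ n E e x y → n * E * (e * x) + y * (E * x) ≡ (n * e + y) * (E * x)
  eq = solve-∀

-- The convexity estimate e^b − e^a ≤ (b − a) e^b, with the last term of the truncation kept.
expTrunc-convex : ∀ E N a u →
  E * expTrunc E N (a + u) + u * (a + u) ^ N ≤ E * expTrunc E N a + u * expTrunc E N (a + u)
expTrunc-convex E zero    a u = ≤-refl
expTrunc-convex E (suc N) a u = begin
  E * (suc N * E * Tb + b * y) + u * (b * y)
    ≡⟨ split E (suc N) u Tb (b * y) ⟩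
  suc N * E * (E * Tb) + E * (b * y) + u * (b * y)
    ≤⟨ +-monoˡ-≤ (u * (b * y)) (+-monoʳ-≤ (suc N * E * (E * Tb)) (*-monoʳ-≤ E (^-+-≤ a u N))) ⟩
  suc N * E * (E * Tb) + E * (a ^ suc N + suc N * u * y) + u * (b * y)
    ≡⟨ regroup E (suc N) u Tb (b * y) (a ^ suc N) y ⟩
  suc N * E * (E * Tb + u * y) + E * a ^ suc N + u * (b * y)
    -- The surplus `u * y` created by the new top term is absorbed by the last term kept in the
    -- induction hypothesis.
    ≤⟨ +-monoˡ-≤ _ (+-monoˡ-≤ _ (*-monoʳ-≤ (suc N * E) (expTrunc-convex E N a u))) ⟩
  suc N * E * (E * Ta + u * Tb) + E * a ^ suc N + u * (b * y)
    ≡⟨ join E (suc N) u Ta Tb (b * y) (a ^ suc N) ⟩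
  E * (suc N * E * Ta + a ^ suc N) + u * (suc N * E * Tb + b * y) ∎
  where
  open ≤-Reasoning
  b  = a + u
  Ta = expTrunc E N a
  Tb = expTrunc E N b
  y  = b ^ N
  split : ∀ E n u T z → E * (n * E * T + z) + u * z ≡ n * E * (E * T) + E * z + u * z
  split = solve-∀
  regroup : ∀ E n u T z x y → n * E * (E * T) + E * (x + n * u * y) + u * z
                            ≡ n * E * (E * T + u * y) + E * x + u * z
  regroup = solve-∀
  join : ∀ E n u S T z x → n * E * (E * S + u * T) + E * x + u * z
                         ≡ E * (n * E * S + x) + u * (n * E * T + z)
  join = solve-∀

-- The truncated form of (1 - y) e^y ≤ 1 with y = u/(w+u). It follows from the convexity estimate
-- once the kept last term is dropped, and both sides use the same truncation.
expTrunc-decrease : ∀ w u N a → w * expTrunc (w + u) N (a + u) ≤ (w + u) * expTrunc (w + u) N a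
expTrunc-decrease w u N a = +-cancelʳ-≤ (u * Tb) _ _ (begin
  w * Tb + u * Tb                  ≡⟨ *-distribʳ-+ Tb w u ⟨
  (w + u) * Tb                     ≤⟨ m≤m+n _ _ ⟩
  (w + u) * Tb + u * (a + u) ^ N   ≤⟨ expTrunc-convex (w + u) N a u ⟩
  (w + u) * expTrunc (w + u) N a + u * Tb ∎)
  where
  open ≤-Reasoning
  Tb = expTrunc (w + u) N (a + u)

-- Second-order Taylor expansion, doubled. In the scaling of `expTrunc`, the derivative in `a` of
-- the truncation of degree m is m times the truncation of degree m - 1. The induction adds
-- `binomial-two-terms` for the top term.
expTrunc-taylor : ∀ E N a d →
  2 * expTrunc E (suc (suc N)) a + 2 * suc (suc N) * d * expTrunc E (suc N) a
    + suc (suc N) * suc N * (d * d) * expTrunc E N a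
    ≤ 2 * expTrunc E (suc (suc N)) (a + d)
expTrunc-taylor E zero a d = begin
  2 * (2 * E * (1 * E * 1 + a * 1) + a * (a * 1)) + 2 * 2 * d * (1 * E * 1 + a * 1) + 2 * 1 * (d * d) * 1
    ≡⟨ eq E a d ⟩
  2 * (2 * E * (1 * E * 1 + (a + d) * 1) + (a + d) * ((a + d) * 1)) ∎
  where
  open ≤-Reasoning
  eq : ∀ E a d →
    2 * (2 * E * (1 * E * 1 + a * 1) + a * (a * 1)) + 2 * 2 * d * (1 * E * 1 + a * 1) + 2 * 1 * (d * d) * 1
    ≡ 2 * (2 * E * (1 * E * 1 + (a + d) * 1) + (a + d) * ((a + d) * 1))
  eq = solve-∀
expTrunc-taylor E (suc N) a d = begin
  2 * (n₃ * E * T₂ + x₃) + 2 * n₃ * d * (n₂ * E * T₁ + x₂) + n₃ * n₂ * (d * d) * (n₁ * E * T₀ + x₁)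
    ≡⟨ regroup E d n₁ n₂ n₃ T₀ T₁ T₂ x₁ x₂ x₃ ⟩
  n₃ * E * (2 * T₂ + 2 * n₂ * d * T₁ + n₂ * n₁ * (d * d) * T₀)
    + (2 * x₃ + 2 * n₃ * d * x₂ + n₃ * n₂ * (d * d) * x₁)
    ≤⟨ +-mono-≤ (*-monoʳ-≤ (n₃ * E) (expTrunc-taylor E N a d)) (binomial-two-terms a d (suc N)) ⟩
  n₃ * E * (2 * expTrunc E n₂ (a + d)) + 2 * (a + d) ^ n₃
    ≡⟨ collect (n₃ * E) (expTrunc E n₂ (a + d)) ((a + d) ^ n₃) ⟩
  2 * expTrunc E n₃ (a + d) ∎
  where
  open ≤-Reasoning
  n₁ = suc N
  n₂ = suc n₁
  n₃ = suc n₂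
  T₀ = expTrunc E N a
  T₁ = expTrunc E n₁ a
  T₂ = expTrunc E n₂ a
  x₁ = a ^ n₁
  x₂ = a ^ n₂
  x₃ = a ^ n₃
  regroup : ∀ E d n₁ n₂ n₃ T₀ T₁ T₂ x₁ x₂ x₃ →
    2 * (n₃ * E * T₂ + x₃) + 2 * n₃ * d * (n₂ * E * T₁ + x₂) + n₃ * n₂ * (d * d) * (n₁ * E * T₀ + x₁)
    ≡ n₃ * E * (2 * T₂ + 2 * n₂ * d * T₁ + n₂ * n₁ * (d * d) * T₀)
      + (2 * x₃ + 2 * n₃ * d * x₂ + n₃ * n₂ * (d * d) * x₁)
  regroup = solve-∀
  collect : ∀ m T x → m * (2 * T) + 2 * x ≡ 2 * (m * T + x)
  collect = solve-∀

-- The truncated form of (1 + δ + δ²/2) e^(a/E) ≤ e^((a+d)/E) with δ = d/E. All truncations on the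
-- left of the Taylor bound are lowered to degree `N` by dropping their top terms, so the price is
-- two degrees.
expTrunc-increase : ∀ E N a d →
  suc (suc N) * suc N * (2 * E * E + 2 * d * E + d * d) * expTrunc E N a
    ≤ 2 * expTrunc E (suc (suc N)) (a + d)
expTrunc-increase E N a d = begin
  n₂ * n₁ * (2 * E * E + 2 * d * E + d * d) * T₀
    ≡⟨ regroup E d n₁ n₂ T₀ ⟩
  2 * (n₂ * E * (n₁ * E * T₀)) + 2 * n₂ * d * (n₁ * E * T₀) + n₂ * n₁ * (d * d) * T₀
    ≤⟨ +-monoˡ-≤ _ (+-mono-≤ (*-monoʳ-≤ 2 (≤-trans (*-monoʳ-≤ (n₂ * E) T₁-lower) (m≤m+n _ _)))
                             (*-monoʳ-≤ (2 * n₂ * d) T₁-lower)) ⟩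
  2 * expTrunc E n₂ a + 2 * n₂ * d * expTrunc E n₁ a + n₂ * n₁ * (d * d) * T₀
    ≤⟨ expTrunc-taylor E N a d ⟩
  2 * expTrunc E n₂ (a + d) ∎
  where
  open ≤-Reasoning
  n₁ = suc N
  n₂ = suc n₁
  T₀ = expTrunc E N a
  T₁-lower : n₁ * E * T₀ ≤ expTrunc E n₁ a
  T₁-lower = m≤m+n _ _
  regroup : ∀ E d n₁ n₂ T →
    n₂ * n₁ * (2 * E * E + 2 * d * E + d * d) * T
    ≡ 2 * (n₂ * E * (n₁ * E * T)) + 2 * n₂ * d * (n₁ * E * T) + n₂ * n₁ * (d * d) * T
  regroup = solve-∀

-- BelowExp E c b a expresses c/b ≤ e^(a/E), witnessed by a partial sum.
BelowExp : (E c b a : ℕ) → Set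
BelowExp E c b a = ∃ λ N → c * (factorial N * E ^ N) ≤ b * expTrunc E N a

-- At exponent 0 every partial sum equals 1, so the exponential disappears and an inequality between
-- natural numbers remains.
belowExp-zero : ∀ {E c b} .{{_ : NonZero E}} → BelowExp E c b 0 → c ≤ b
belowExp-zero {E} {c} {b} (N , h) = *-cancelʳ-≤ c b (factorial N * E ^ N)
  (≤-trans h (≤-reflexive (cong (b *_) (expTrunc-zero E N))))
  where
  instance
    _ : NonZero (factorial N * E ^ N)
    _ = m*n≢0 (factorial N) (E ^ N) {{factorial≢0 N}} {{m^n≢0 E N}}

-- Writing the integer exponent `A` as `A * E` over `E` lets all later fractional changes of the
-- exponent share one denominator.
lnLeq⇒belowExp : ∀ E m A B → LnLeq m A B → BelowExp E (m ^ B) 1 (A * E)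
lnLeq⇒belowExp E m A B (N , h) = N , (begin
  m ^ B * (factorial N * E ^ N)   ≡⟨ *-assoc (m ^ B) (factorial N) (E ^ N) ⟨
  m ^ B * factorial N * E ^ N     ≤⟨ *-monoˡ-≤ (E ^ N) h ⟩
  expScaled A N * E ^ N           ≡⟨ expTrunc-integral E N A ⟨
  expTrunc E N (A * E)            ≡⟨ *-identityˡ _ ⟨
  1 * expTrunc E N (A * E)        ∎)
  where open ≤-Reasoning

-- Dividing by e^y with y = u/(w+u) is compensated by the factor w/(w+u) = 1 - y ≤ e^(-y). The
-- truncation degree stays the same.
belowExp-decrease : ∀ w u {c b} a →
  BelowExp (w + u) c b (a + u) → BelowExp (w + u) (c * w) (b * (w + u)) a
belowExp-decrease w u {c} {b} a (N , h) = N , (begin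
  c * w * F                                   ≡⟨ eq c w F ⟩
  w * (c * F)                                 ≤⟨ *-monoʳ-≤ w h ⟩
  w * (b * expTrunc (w + u) N (a + u))        ≡⟨ eq′ w b _ ⟩
  b * (w * expTrunc (w + u) N (a + u))        ≤⟨ *-monoʳ-≤ b (expTrunc-decrease w u N a) ⟩
  b * ((w + u) * expTrunc (w + u) N a)        ≡⟨ *-assoc b (w + u) _ ⟨
  b * (w + u) * expTrunc (w + u) N a          ∎)
  where
  open ≤-Reasoning
  F = factorial N * (w + u) ^ N
  eq : ∀ c w F → c * w * F ≡ w * (c * F)
  eq = solve-∀
  eq′ : ∀ w b T → w * (b * T) ≡ b * (w * T)
  eq′ = solve-∀

-- The hypothesis reads s/t ≤ 1 + δ + δ²/2 with δ = d/E.
belowExp-increase : ∀ E d s t {c b} a →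
  2 * E * E * s ≤ (2 * E * E + 2 * d * E + d * d) * t →
  BelowExp E c b a → BelowExp E (c * s) (b * t) (a + d)
-- The witness grows by the two degrees that `expTrunc-increase` costs.
belowExp-increase E d s t {c} {b} a st (N , h) = suc (suc N) , *-cancelˡ-≤ 2 (begin
  2 * (c * s * (suc (suc N) * (suc N * factorial N) * (E * (E * E ^ N))))
    ≡⟨ regroup E s c (suc N) (suc (suc N)) (factorial N) (E ^ N) ⟩
  suc (suc N) * suc N * (c * (factorial N * E ^ N)) * (2 * E * E * s)
    ≤⟨ *-mono-≤ (*-monoʳ-≤ (suc (suc N) * suc N) h) st ⟩
  suc (suc N) * suc N * (b * expTrunc E N a) * (Q * t)
    ≡⟨ regroup′ b t (suc (suc N) * suc N) Q (expTrunc E N a) ⟩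
  b * t * (suc (suc N) * suc N * Q * expTrunc E N a)
    ≤⟨ *-monoʳ-≤ (b * t) (expTrunc-increase E N a d) ⟩
  b * t * (2 * expTrunc E (suc (suc N)) (a + d))
    ≡⟨ comm (b * t) (expTrunc E (suc (suc N)) (a + d)) ⟩
  2 * (b * t * expTrunc E (suc (suc N)) (a + d)) ∎)
  where
  open ≤-Reasoning
  Q = 2 * E * E + 2 * d * E + d * d
  regroup : ∀ E s c m n f x → 2 * (c * s * (n * (m * f) * (E * (E * x))))
                            ≡ n * m * (c * (f * x)) * (2 * E * E * s)
  regroup = solve-∀
  regroup′ : ∀ b t n Q T → n * (b * T) * (Q * t) ≡ b * t * (n * Q * T)
  regroup′ = solve-∀
  comm : ∀ m T → m * (2 * T) ≡ 2 * (m * T)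
  comm = solve-∀

belowExp-increase^ : ∀ E d s t m {c b} a →
  2 * E * E * s ≤ (2 * E * E + 2 * d * E + d * d) * t →
  BelowExp E c b a → BelowExp E (c * s ^ m) (b * t ^ m) (a + m * d)
belowExp-increase^ E d s t zero {c} {b} a st h
  rewrite *-identityʳ c | *-identityʳ b | +-identityʳ a = h
belowExp-increase^ E d s t (suc m) {c} {b} a st h
  rewrite sym (*-assoc c s (s ^ m)) | sym (*-assoc b t (t ^ m)) | sym (+-assoc a d (m * d))
  = belowExp-increase^ E d s t m {c * s} {b * t} (a + d) st (belowExp-increase E d s t {c} {b} a st h)

-- The exponent is chosen to be used up by exactly `m` decreases, after which `belowExp-zero`
-- applies.
belowExp-decrease^ : ∀ w u m {c b} .{{_ : NonZero (w + u)}} →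
  BelowExp (w + u) c b (m * u) → c * w ^ m ≤ b * (w + u) ^ m
belowExp-decrease^ w u zero {c} {b} h
  rewrite *-identityʳ c | *-identityʳ b = belowExp-zero {w + u} {c} {b} h
belowExp-decrease^ w u (suc m) {c} {b} h
  rewrite sym (*-assoc c w (w ^ m)) | sym (*-assoc b (w + u) ((w + u) ^ m)) | +-comm u (m * u)
  = belowExp-decrease^ w u m {c * w} {b * (w + u)} (belowExp-decrease w u {c} {b} (m * u) h)

-- The tail estimate

^-cancelʳ-≤ : ∀ m n e .{{_ : NonZero e}} → m ^ e ≤ n ^ e → m ≤ n
^-cancelʳ-≤ m n e mᵉ≤nᵉ = ≮⇒≥ λ n<m → <⇒≱ (^-monoˡ-< e n<m) mᵉ≤nᵉ

-- With δ = p/q, q = p + r: the ratio num/den equals 1 − δ + δ²/2, an upper bound for e^(−δ).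
den num gap : ℕ → ℕ → ℕ
den p r = 2 * ((p + r) * (p + r))
num p r = (p + r) * (p + r) + r * r
gap p r = p * p + 2 * p * r

den≡num+gap : ∀ p r → den p r ≡ num p r + gap p r
den≡num+gap = eq
  where
  eq : ∀ p r → 2 * ((p + r) * (p + r)) ≡ (p + r) * (p + r) + r * r + (p * p + 2 * p * r)
  eq = solve-∀

num≤den : ∀ p r → num p r ≤ den p r
num≤den p r = ≤-trans (m≤m+n _ _) (≤-reflexive (sym (den≡num+gap p r)))

den≢0 : ∀ p r → 0 < p → NonZero (den p r)
den≢0 (suc p) r _ = _

num≢0 : ∀ p r → 0 < p → NonZero (num p r)
num≢0 (suc p) r _ = _

-- residue f p r = f · den − gap, without truncated subtraction.
residue : ℕ → ℕ → ℕ → ℕ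
residue f p r = pred f * den p r + num p r

-- Hence residue/(f · den) is 1 - (1-t)/f for t = num/den: the mean of a weight that is t on success
-- and 1 on failure, when success has probability 1/f.
residue+gap : ∀ f p r .{{_ : NonZero f}} → residue f p r + gap p r ≡ f * den p r
residue+gap (suc f) p r = begin
  f * den p r + num p r + gap p r     ≡⟨ +-assoc (f * den p r) _ _ ⟩
  f * den p r + (num p r + gap p r)   ≡⟨ cong (f * den p r +_) (den≡num+gap p r) ⟨
  f * den p r + den p r               ≡⟨ +-comm (f * den p r) _ ⟩
  den p r + f * den p r               ∎
  where open ≡-Reasoning

-- Here d/E = p/q = δ, and the claim 1/t ≤ 1 + δ + δ²/2 rests on (1 - δ + δ²/2)(1 + δ + δ²/2) = 1 +
-- δ⁴/4. The term added in the proof is that δ⁴/4, cleared of denominators.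
den/num≤taylor : ∀ f p r → let E = f * den p r ; d = 2 * p * (p + r) * f in
  2 * E * E * den p r ≤ (2 * E * E + 2 * d * E + d * d) * num p r
den/num≤taylor f p r = ≤-trans (m≤m+n _ _) (≤-reflexive (eq f p r))
  where
  eq : ∀ f p r →
    2 * (f * (2 * ((p + r) * (p + r)))) * (f * (2 * ((p + r) * (p + r)))) * (2 * ((p + r) * (p + r)))
      + 4 * ((p + r) * (p + r)) * (f * f) * (p * p * p * p)
    ≡ (2 * (f * (2 * ((p + r) * (p + r)))) * (f * (2 * ((p + r) * (p + r))))
        + 2 * (2 * p * (p + r) * f) * (f * (2 * ((p + r) * (p + r))))
        + 2 * p * (p + r) * f * (2 * p * (p + r) * f)) * ((p + r) * (p + r) + r * r)
  eq = solve-∀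

-- The Chernoff bound (1 − (1−t)/f)^ξ t^(−x) ≤ n^(−(k+1)) with t = num/den, cleared of denominators.
lnLeq⇒tail≤ : ∀ n k ξ p r f x .{{_ : NonZero f}} → 0 < p →
  LnLeq n (ξ * (p * p)) (2 * (suc k * f) * ((p + r) * (p + r))) →
  x * (f * (p + r)) ≤ r * ξ →
  n ^ suc k * (den p r ^ x * residue f p r ^ ξ) ≤ num p r ^ x * (f * den p r) ^ ξ
-- Passing to `E`-th powers makes the exponents integral: the hypothesis then speaks of n^((k+1)E),
-- and (1-δ)ξ/f becomes the integer `C`.
lnLeq⇒tail≤ n k ξ p r f x 0<p ln≤ x-bound = ^-cancelʳ-≤ _ _ E (begin
  (n ^ suc k * (s ^ x * w ^ ξ)) ^ E
    ≡⟨ ^-distribʳ-* E (n ^ suc k) _ ⟩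
  (n ^ suc k) ^ E * (s ^ x * w ^ ξ) ^ E
    ≡⟨ cong₂ _*_ (^-*-assoc n (suc k) E) (^-distribʳ-* E (s ^ x) (w ^ ξ)) ⟩
  n ^ (suc k * E) * ((s ^ x) ^ E * (w ^ ξ) ^ E)
    ≡⟨ cong₂ (λ a b → n ^ (suc k * E) * (a * b)) (^-*-assoc s x E) (^-*-assoc w ξ E) ⟩
  n ^ (suc k * E) * (s ^ (x * E) * w ^ (ξ * E))
    ≤⟨ powers ⟩
  t ^ (x * E) * E ^ (ξ * E)
    ≡⟨ cong₂ _*_ (^-*-assoc t x E) (^-*-assoc E ξ E) ⟨
  (t ^ x) ^ E * (E ^ ξ) ^ E
    ≡⟨ ^-distribʳ-* E (t ^ x) (E ^ ξ) ⟨
  (t ^ x * E ^ ξ) ^ E ∎)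
  where
  open ≤-Reasoning
  q = p + r
  s = den p r
  t = num p r
  u = gap p r
  w = residue f p r
  E = f * s
  d = 2 * p * q * f
  -- `C` equals E · (1-δ)ξ/f exactly; `x * E` is at most this.
  C = 2 * q * (r * ξ)
  B = 2 * (suc k * f) * (q * q)

  instance
    s≢0 : NonZero s
    s≢0 = den≢0 p r 0<p
    t≢0 : NonZero t
    t≢0 = num≢0 p r 0<p
    E≢0 : NonZero E
    E≢0 = m*n≢0 f s

  -- The exact balance of exponents: what the logarithm hypothesis gives, plus δ for each of `C`
  -- factors s/t, is consumed by ξE factors 1 - u/E.
  exponents : ξ * (p * p) * E + C * d ≡ ξ * E * u
  exponents = eq ξ p r f
    where
    eq : ∀ ξ p r f →
      ξ * (p * p) * (f * (2 * ((p + r) * (p + r)))) + 2 * (p + r) * (r * ξ) * (2 * p * (p + r) * f)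
      ≡ ξ * (f * (2 * ((p + r) * (p + r)))) * (p * p + 2 * p * r)
    eq = solve-∀

  B≡ : B ≡ suc k * E
  B≡ = eq (suc k) f (q * q)
    where
    eq : ∀ k f q → 2 * (k * f) * q ≡ k * (f * (2 * q))
    eq = solve-∀

  increased : BelowExp E (n ^ B * s ^ C) (1 * t ^ C) (ξ * E * u)
  increased = subst (BelowExp E (n ^ B * s ^ C) (1 * t ^ C)) exponents
    (belowExp-increase^ E d s t C {n ^ B} {1} (ξ * (p * p) * E) (den/num≤taylor f p r)
      (lnLeq⇒belowExp E n (ξ * (p * p)) B ln≤))

  -- `residue+gap` is only a propositional equality, so the denominator is abstracted and becomes
  -- `w + u` on matching `refl`. The exponents keep `f * s` so that they are left untouched.
  decreased : ∀ E → .{{NonZero E}} → w + u ≡ E → BelowExp E (n ^ B * s ^ C) (1 * t ^ C) (ξ * (f * s) * u) →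
    n ^ B * s ^ C * w ^ (ξ * (f * s)) ≤ 1 * t ^ C * E ^ (ξ * (f * s))
  decreased _ refl h = belowExp-decrease^ w u (ξ * (f * s)) {n ^ B * s ^ C} {1 * t ^ C} h

  xE≤C : x * E ≤ C
  xE≤C = begin
    x * E                   ≡⟨ eq x f q ⟩
    2 * q * (x * (f * q))   ≤⟨ *-monoʳ-≤ (2 * q) x-bound ⟩
    C                       ∎
    where
    eq : ∀ x f q → x * (f * (2 * (q * q))) ≡ 2 * q * (x * (f * q))
    eq = solve-∀

  z = C ∸ x * E

  ^C : ∀ b → b ^ C ≡ b ^ (x * E) * b ^ z
  ^C b = trans (cong (b ^_) (sym (m+[n∸m]≡n xE≤C))) (^-distribˡ-+-* b (x * E) z)

  powers : n ^ (suc k * E) * (s ^ (x * E) * w ^ (ξ * E)) ≤ t ^ (x * E) * E ^ (ξ * E)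
  powers = *-cancelʳ-≤ _ _ (t ^ z) {{m^n≢0 t z}} (begin
    n ^ (suc k * E) * (s ^ (x * E) * w ^ (ξ * E)) * t ^ z
      -- The slack `z` between `C` and `x * E` is harmless because t ≤ s: it turns `t ^ z` into the
      -- `s ^ z` missing from `s ^ C`.
      ≤⟨ *-monoʳ-≤ (n ^ (suc k * E) * (s ^ (x * E) * w ^ (ξ * E))) (^-monoˡ-≤ z (num≤den p r)) ⟩
    n ^ (suc k * E) * (s ^ (x * E) * w ^ (ξ * E)) * s ^ z
      ≡⟨ eq (n ^ (suc k * E)) (s ^ (x * E)) (w ^ (ξ * E)) (s ^ z) ⟩
    n ^ (suc k * E) * (s ^ (x * E) * s ^ z) * w ^ (ξ * E)
      ≡⟨ cong₂ (λ a b → n ^ a * b * w ^ (ξ * E)) B≡ (^C s) ⟨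
    n ^ B * s ^ C * w ^ (ξ * E)
      ≤⟨ decreased E (residue+gap f p r) increased ⟩
    1 * t ^ C * E ^ (ξ * E)
      ≡⟨ cong (λ a → 1 * a * E ^ (ξ * E)) (^C t) ⟩
    1 * (t ^ (x * E) * t ^ z) * E ^ (ξ * E)
      ≡⟨ eq′ (t ^ (x * E)) (t ^ z) (E ^ (ξ * E)) ⟩
    t ^ (x * E) * E ^ (ξ * E) * t ^ z ∎)
    where
    eq : ∀ a b c d → a * (b * c) * d ≡ a * (b * d) * c
    eq = solve-∀
    eq′ : ∀ a b c → 1 * (a * b) * c ≡ a * c * b
    eq′ = solve-∀

-- Sums, counting and the Chernoff bound

private variable
  A B : Set

∑ : (A → ℕ) → List A → ℕ
∑ f xs = sum (map f xs)

∑-mono : ∀ {f g : A → ℕ} {xs} → All (λ x → f x ≤ g x) xs → ∑ f xs ≤ ∑ g xs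
∑-mono []       = z≤n
∑-mono (h ∷ hs) = +-mono-≤ h (∑-mono hs)

∑-cong : ∀ {f g : A → ℕ} → (∀ x → f x ≡ g x) → ∀ xs → ∑ f xs ≡ ∑ g xs
∑-cong f≗g xs = cong sum (map-cong f≗g xs)

∑-+ : ∀ (f g : A → ℕ) xs → ∑ (λ x → f x + g x) xs ≡ ∑ f xs + ∑ g xs
∑-+ f g []       = refl
∑-+ f g (x ∷ xs) = trans (cong (f x + g x +_) (∑-+ f g xs)) (eq (f x) (g x) (∑ f xs) (∑ g xs))
  where
  eq : ∀ a b c d → a + b + (c + d) ≡ a + c + (b + d)
  eq = solve-∀

∑-*ˡ : ∀ c (f : A → ℕ) xs → ∑ (λ x → c * f x) xs ≡ c * ∑ f xs
∑-*ˡ c f []       = sym (*-zeroʳ c)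
∑-*ˡ c f (x ∷ xs) = trans (cong (c * f x +_) (∑-*ˡ c f xs)) (sym (*-distribˡ-+ c (f x) _))

∑-*ʳ : ∀ (f : A → ℕ) c xs → ∑ (λ x → f x * c) xs ≡ ∑ f xs * c
∑-*ʳ f c xs = trans (∑-cong (λ x → *-comm (f x) c) xs) (trans (∑-*ˡ c f xs) (*-comm c _))

∑-const : ∀ c (xs : List A) → ∑ (λ _ → c) xs ≡ length xs * c
∑-const c []       = refl
∑-const c (x ∷ xs) = cong (c +_) (∑-const c xs)

∑-++ : ∀ (f : A → ℕ) xs ys → ∑ f (xs ++ ys) ≡ ∑ f xs + ∑ f ys
∑-++ f xs ys = trans (cong sum (map-++ f xs ys)) (sum-++ (map f xs) (map f ys))

∑-map : ∀ (f : B → ℕ) (g : A → B) xs → ∑ f (map g xs) ≡ ∑ (f ∘ g) xs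
∑-map f g xs = cong sum (sym (map-∘ xs))

∑-concatMap : ∀ (f : B → ℕ) (g : A → List B) xs → ∑ f (concatMap g xs) ≡ ∑ (λ x → ∑ f (g x)) xs
∑-concatMap f g []       = refl
∑-concatMap f g (x ∷ xs) = trans (∑-++ f (g x) (concatMap g xs)) (cong (∑ f (g x) +_) (∑-concatMap f g xs))

∑-swap : ∀ (f : A → B → ℕ) xs ys → ∑ (λ x → ∑ (f x) ys) xs ≡ ∑ (λ y → ∑ (λ x → f x y) xs) ys
∑-swap f []       ys = sym (trans (∑-const 0 ys) (*-zeroʳ (length ys)))
∑-swap f (x ∷ xs) ys = trans (cong (∑ (f x) ys +_) (∑-swap f xs ys))
  (sym (∑-+ (f x) (λ y → ∑ (λ x → f x y) xs) ys))

𝟙 : Bool → ℕ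
𝟙 b = if b then 1 else 0

count : (A → Bool) → List A → ℕ
count P xs = length (filterᵇ P xs)

count≡∑ : ∀ (P : A → Bool) xs → count P xs ≡ ∑ (𝟙 ∘ P) xs
count≡∑ P []       = refl
count≡∑ P (x ∷ xs) with P x
... | true  = cong suc (count≡∑ P xs)
... | false = count≡∑ P xs

count-all : ∀ (xs : List A) → count (λ _ → true) xs ≡ length xs
count-all []       = refl
count-all (x ∷ xs) = cong suc (count-all xs)

markov : ∀ (P : A → Bool) (h : A → ℕ) c → (∀ x → T (P x) → c ≤ h x) → ∀ xs → count P xs * c ≤ ∑ h xs
markov P h c bound xs = begin
  count P xs * c            ≡⟨ cong (_* c) (count≡∑ P xs) ⟩
  ∑ (𝟙 ∘ P) xs * c          ≡⟨ ∑-*ʳ (𝟙 ∘ P) c xs ⟨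
  ∑ (λ x → 𝟙 (P x) * c) xs  ≤⟨ ∑-mono (All.universal pointwise xs) ⟩
  ∑ h xs                    ∎
  where
  open ≤-Reasoning
  pointwise : ∀ x → 𝟙 (P x) * c ≤ h x
  pointwise x with P x | bound x
  ... | true  | b = ≤-trans (≤-reflexive (+-identityʳ c)) (b _)
  ... | false | _ = z≤n

union-bound : ∀ (R : A → B → Bool) xs ys →
  length xs ≤ count (λ x → all (R x) ys) xs + ∑ (λ y → count (λ x → not (R x y)) xs) ys
union-bound R xs []       = ≤-trans (≤-reflexive (sym (count-all xs))) (m≤m+n _ _)
union-bound R xs (y ∷ ys) = begin
  length xs
    ≤⟨ union-bound R xs ys ⟩
  count Q xs + S
    ≡⟨ cong (_+ S) (count≡∑ Q xs) ⟩
  ∑ (𝟙 ∘ Q) xs + S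
    ≤⟨ +-monoˡ-≤ S (∑-mono (All.universal (λ x → split (R x y) (Q x)) xs)) ⟩
  ∑ (λ x → 𝟙 (R x y ∧ Q x) + 𝟙 (not (R x y))) xs + S
    ≡⟨ cong (_+ S) (∑-+ (λ x → 𝟙 (R x y ∧ Q x)) (λ x → 𝟙 (not (R x y))) xs) ⟩
  ∑ (λ x → 𝟙 (R x y ∧ Q x)) xs + ∑ (λ x → 𝟙 (not (R x y))) xs + S
    ≡⟨ cong₂ (λ a b → a + b + S) (count≡∑ (λ x → R x y ∧ Q x) xs) (count≡∑ (λ x → not (R x y)) xs) ⟨
  count (λ x → R x y ∧ Q x) xs + count (λ x → not (R x y)) xs + S
    ≡⟨ +-assoc (count (λ x → R x y ∧ Q x) xs) _ S ⟩
  count (λ x → R x y ∧ Q x) xs + (count (λ x → not (R x y)) xs + S) ∎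
  where
  open ≤-Reasoning
  Q = λ x → all (R x) ys
  S = ∑ (λ y → count (λ x → not (R x y)) xs) ys
  split : ∀ b c → 𝟙 c ≤ 𝟙 (b ∧ c) + 𝟙 (not b)
  split true  c     = m≤m+n _ _
  split false true  = ≤-refl
  split false false = z≤n

-- Independence of the draws: a product of weights, one per coordinate, has a total that factorises.
∑-allVecs : ∀ (g : A → ℕ) m xs → ∑ (λ v → product (map g (toList v))) (allVecs m xs) ≡ ∑ g xs ^ m
∑-allVecs g zero    xs = refl
∑-allVecs {A = A} g (suc m) xs = begin
  ∑ weight (concatMap (λ x → map (x ∷_) (allVecs m xs)) xs)
    ≡⟨ ∑-concatMap weight (λ x → map (x ∷_) (allVecs m xs)) xs ⟩
  ∑ (λ x → ∑ weight (map (x ∷_) (allVecs m xs))) xs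
    ≡⟨ ∑-cong (λ x → trans (∑-map weight (x ∷_) (allVecs m xs)) (∑-*ˡ (g x) weight (allVecs m xs))) xs ⟩
  ∑ (λ x → g x * ∑ weight (allVecs m xs)) xs
    ≡⟨ ∑-*ʳ g (∑ weight (allVecs m xs)) xs ⟩
  ∑ g xs * ∑ weight (allVecs m xs)
    ≡⟨ cong (∑ g xs *_) (∑-allVecs g m xs) ⟩
  ∑ g xs * ∑ g xs ^ m ∎
  where
  open ≡-Reasoning
  weight : ∀ {m} → Vec A m → ℕ
  weight v = product (map g (toList v))

length-allVecs : ∀ m (xs : List A) → length (allVecs m xs) ≡ length xs ^ m
length-allVecs m xs = begin
  length (allVecs m xs)                                           ≡⟨ *-identityʳ _ ⟨
  length (allVecs m xs) * 1                                       ≡⟨ ∑-const 1 (allVecs m xs) ⟨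
  ∑ (λ _ → 1) (allVecs m xs)                                      ≡⟨ ∑-cong (λ v → ones (toList v)) (allVecs m xs) ⟨
  ∑ (λ v → product (map (λ _ → 1) (toList v))) (allVecs m xs)     ≡⟨ ∑-allVecs (λ _ → 1) m xs ⟩
  ∑ (λ _ → 1) xs ^ m                                              ≡⟨ cong (_^ m) (trans (∑-const 1 xs) (*-identityʳ _)) ⟩
  length xs ^ m                                                   ∎
  where
  open ≡-Reasoning
  ones : ∀ (ys : List _) → product (map (λ _ → 1) ys) ≡ 1
  ones []       = refl
  ones (_ ∷ ys) = trans (+-identityʳ _) (ones ys)

-- The exponential weight of Chernoff's method for a lower tail, with t/s in the role of e^(-λ) and
-- scaled by `s` to stay integral.
tilt : ℕ → ℕ → Bool → ℕ
tilt s t b = if b then t else s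

tilt-product : ∀ s t (f : A → Bool) {m} (v : Vec A m) →
  product (map (tilt s t ∘ f) (toList v)) * s ^ count f (toList v) ≡ t ^ count f (toList v) * s ^ m
tilt-product s t f []      = refl
tilt-product s t f {suc m} (x ∷ v) with f x
... | true  = begin
  t * W * (s * s ^ c)      ≡⟨ eq t W s (s ^ c) ⟩
  t * s * (W * s ^ c)      ≡⟨ cong (t * s *_) (tilt-product s t f v) ⟩
  t * s * (t ^ c * s ^ m)  ≡⟨ eq t s (t ^ c) (s ^ m) ⟩
  t * t ^ c * (s * s ^ m)  ∎
  where
  open ≡-Reasoning
  W = product (map (tilt s t ∘ f) (toList v))
  c = count f (toList v)
  eq : ∀ a b c d → a * b * (c * d) ≡ a * c * (b * d)
  eq = solve-∀
... | false = begin
  s * W * s ^ c        ≡⟨ *-assoc s W _ ⟩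
  s * (W * s ^ c)      ≡⟨ cong (s *_) (tilt-product s t f v) ⟩
  s * (t ^ c * s ^ m)  ≡⟨ eq s (t ^ c) (s ^ m) ⟩
  t ^ c * (s * s ^ m)  ∎
  where
  open ≡-Reasoning
  W = product (map (tilt s t ∘ f) (toList v))
  c = count f (toList v)
  eq : ∀ a b c → a * (b * c) ≡ b * (a * c)
  eq = solve-∀

-- The weight of a sample is s^m (t/s)^c with c successes. Since t ≤ s, it only grows as c drops
-- below `x`.
tilt-product-≥ : ∀ s t x (f : A → Bool) {m} (v : Vec A m) .{{_ : NonZero s}} → t ≤ s → count f (toList v) ≤ x →
  t ^ x * s ^ m ≤ product (map (tilt s t ∘ f) (toList v)) * s ^ x
tilt-product-≥ s t x f {m} v t≤s c≤x = begin
  t ^ x * s ^ m                      ≡⟨ cong (_* s ^ m) (split t) ⟩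
  t ^ c * t ^ (x ∸ c) * s ^ m        ≤⟨ *-monoˡ-≤ (s ^ m) (*-monoʳ-≤ (t ^ c) (^-monoˡ-≤ (x ∸ c) t≤s)) ⟩
  t ^ c * s ^ (x ∸ c) * s ^ m        ≡⟨ eq (t ^ c) (s ^ (x ∸ c)) (s ^ m) ⟩
  t ^ c * s ^ m * s ^ (x ∸ c)        ≡⟨ cong (_* s ^ (x ∸ c)) (tilt-product s t f v) ⟨
  W * s ^ c * s ^ (x ∸ c)            ≡⟨ *-assoc W _ _ ⟩
  W * (s ^ c * s ^ (x ∸ c))          ≡⟨ cong (W *_) (split s) ⟨
  W * s ^ x                          ∎
  where
  open ≤-Reasoning
  W = product (map (tilt s t ∘ f) (toList v))
  c = count f (toList v)
  split : ∀ b → b ^ x ≡ b ^ c * b ^ (x ∸ c)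
  split b = trans (cong (b ^_) (sym (m+[n∸m]≡n c≤x))) (^-distribˡ-+-* b c (x ∸ c))
  eq : ∀ a b c → a * b * c ≡ a * c * b
  eq = solve-∀

-- Markov's inequality for the product weight, whose total is evaluated by independence.
chernoff : ∀ s t x (f : A → Bool) {m} (P : Vec A m → Bool) .{{_ : NonZero s}} → t ≤ s →
  (∀ v → T (P v) → count f (toList v) ≤ x) → ∀ xs →
  count P (allVecs m xs) * (t ^ x * s ^ m) ≤ ∑ (tilt s t ∘ f) xs ^ m * s ^ x
chernoff s t x f {m} P t≤s bound xs = begin
  count P (allVecs m xs) * (t ^ x * s ^ m)
    ≤⟨ markov P _ _ (λ v Pv → tilt-product-≥ s t x f v t≤s (bound v Pv)) (allVecs m xs) ⟩
  ∑ (λ v → product (map (tilt s t ∘ f) (toList v)) * s ^ x) (allVecs m xs)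
    ≡⟨ ∑-*ʳ (λ v → product (map (tilt s t ∘ f) (toList v))) (s ^ x) (allVecs m xs) ⟩
  ∑ (λ v → product (map (tilt s t ∘ f) (toList v))) (allVecs m xs) * s ^ x
    ≡⟨ cong (_* s ^ x) (∑-allVecs (tilt s t ∘ f) m xs) ⟩
  ∑ (tilt s t ∘ f) xs ^ m * s ^ x ∎
  where open ≤-Reasoning

-- Each success lowers the weight by exactly `u`, so restoring `u` per success makes the weight
-- constant.
∑-tilt : ∀ t u (f : A → Bool) xs →
  ∑ (tilt (t + u) t ∘ f) xs + count f xs * u ≡ length xs * (t + u)
∑-tilt t u f xs = begin
  ∑ (tilt (t + u) t ∘ f) xs + count f xs * u
    ≡⟨ cong (λ c → ∑ (tilt (t + u) t ∘ f) xs + c * u) (count≡∑ f xs) ⟩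
  ∑ (tilt (t + u) t ∘ f) xs + ∑ (𝟙 ∘ f) xs * u
    ≡⟨ cong (∑ (tilt (t + u) t ∘ f) xs +_) (∑-*ʳ (𝟙 ∘ f) u xs) ⟨
  ∑ (tilt (t + u) t ∘ f) xs + ∑ (λ x → 𝟙 (f x) * u) xs
    ≡⟨ ∑-+ (tilt (t + u) t ∘ f) (λ x → 𝟙 (f x) * u) xs ⟨
  ∑ (λ x → tilt (t + u) t (f x) + 𝟙 (f x) * u) xs
    ≡⟨ ∑-cong (λ x → pointwise (f x)) xs ⟩
  ∑ (λ _ → t + u) xs
    ≡⟨ ∑-const (t + u) xs ⟩
  length xs * (t + u) ∎
  where
  open ≡-Reasoning
  pointwise : ∀ b → tilt (t + u) t b + 𝟙 b * u ≡ t + u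
  pointwise true  = cong (t +_) (+-identityʳ u)
  pointwise false = +-identityʳ (t + u)

-- Symmetry of uniformly random permutations

-- Pigeonhole: the head is cut out of `ys`, and uniqueness keeps the tail inside what remains.
unique-⊆⇒length≤ : ∀ {xs ys : List A} → Unique xs → xs ⊆ ys → length xs ≤ length ys
unique-⊆⇒length≤ []             _     = z≤n
unique-⊆⇒length≤ {xs = x ∷ xs} (x∉xs ∷ xs!) xs⊆ys with ∈-∃++ (xs⊆ys (here refl))
... | as , bs , refl = begin
  suc (length xs)          ≤⟨ s≤s (unique-⊆⇒length≤ xs! xs⊆as++bs) ⟩
  suc (length (as ++ bs))  ≡⟨ length-++-sucʳ as x bs ⟨
  length (as ++ x ∷ bs)    ∎
  where
  open ≤-Reasoning
  xs⊆as++bs : xs ⊆ as ++ bs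
  xs⊆as++bs z∈xs with ∈-++⁻ as (xs⊆ys (there z∈xs))
  ... | inj₁ z∈as           = ∈-++⁺ˡ z∈as
  ... | inj₂ (here refl)    = contradiction refl (All.lookup x∉xs z∈xs)
  ... | inj₂ (there z∈bs)   = ∈-++⁺ʳ as z∈bs

count-injection : ∀ (P Q : A → Bool) (f : A → A) {xs} → (∀ {x y} → f x ≡ f y → x ≡ y) → Unique xs →
  (∀ {x} → x ∈ xs → T (P x) → f x ∈ xs × T (Q (f x))) → count P xs ≤ count Q xs
count-injection P Q f {xs} f-inj xs! maps = begin
  length (filterᵇ P xs)          ≡⟨ length-map f (filterᵇ P xs) ⟨
  length (map f (filterᵇ P xs))  ≤⟨ unique-⊆⇒length≤ (Unique.map⁺ f-inj (Unique.filter⁺ (T? ∘ P) xs!)) image⊆ ⟩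
  length (filterᵇ Q xs)          ∎
  where
  open ≤-Reasoning
  image⊆ : map f (filterᵇ P xs) ⊆ filterᵇ Q xs
  image⊆ y∈ with ∈-map⁻ f y∈
  ... | x , x∈ , refl with ∈-filter⁻ (T? ∘ P) x∈
  ... | x∈xs , Px with maps x∈xs Px
  ... | fx∈xs , Qfx = ∈-filter⁺ (T? ∘ Q) fx∈xs Qfx

-- This form makes the library results on Cartesian products applicable to `allVecs`.
allVecs-suc : ∀ m (xs : List A) → allVecs (suc m) xs ≡ cartesianProductWith _∷_ xs (allVecs m xs)
allVecs-suc {A = A} m xs = go xs
  where
  go : ∀ (ys : List A) →
    concatMap (λ x → map (Vec._∷_ x) (allVecs m xs)) ys ≡ cartesianProductWith _∷_ ys (allVecs m xs)
  go []       = refl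
  go (y ∷ ys) = cong (map (y ∷_) (allVecs m xs) ++_) (go ys)

allVecs-unique : ∀ m {xs : List A} → Unique xs → Unique (allVecs m xs)
allVecs-unique zero    xs! = [] ∷ []
allVecs-unique (suc m) {xs} xs! = subst Unique (sym (allVecs-suc m xs))
  (Unique.cartesianProductWith⁺ _∷_ Vec.∷-injective xs! (allVecs-unique m xs!))

∈-allVecs : ∀ {m} {xs : List A} → (∀ x → x ∈ xs) → ∀ (v : Vec A m) → v ∈ allVecs m xs
∈-allVecs ∈xs []      = here refl
∈-allVecs {m = suc m} {xs} ∈xs (x ∷ v) = subst (x ∷ v ∈_) (sym (allVecs-suc m xs))
  (∈-cartesianProductWith⁺ _∷_ (∈xs x) (∈-allVecs ∈xs v))

distinctᵇ⇒unique : ∀ {n} (xs : List (Fin n)) → T (distinctᵇ xs) → Unique xs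
distinctᵇ⇒unique []       _ = []
distinctᵇ⇒unique {n} (x ∷ xs) h with Equivalence.to T-∧ h
... | fresh , rest = all≢ xs fresh ∷ distinctᵇ⇒unique xs rest
  where
  all≢ : ∀ (ys : List (Fin n)) → T (not (any (λ y → ⌊ x Fin.≟ y ⌋) ys)) → All (x ≢_) ys
  all≢ []       _ = []
  all≢ (y ∷ ys) h with x Fin.≟ y
  ... | no x≢y = x≢y ∷ all≢ ys h

unique⇒distinctᵇ : ∀ {n} {xs : List (Fin n)} → Unique xs → T (distinctᵇ xs)
unique⇒distinctᵇ []                = _
unique⇒distinctᵇ {n} {x ∷ xs} (x∉xs ∷ xs!) = Equivalence.from T-∧ (all≢ x∉xs , unique⇒distinctᵇ xs!)
  where
  all≢ : ∀ {ys : List (Fin n)} → All (x ≢_) ys → T (not (any (λ y → ⌊ x Fin.≟ y ⌋) ys))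
  all≢ []       = _
  all≢ {y ∷ ys} (x≢y ∷ h) with x Fin.≟ y
  ... | yes x≡y = contradiction x≡y x≢y
  ... | no  _   = all≢ h

toList-unique⁺ : ∀ {m} {v : Vec A m} → VecUnique.Unique v → Unique (toList v)
toList-unique⁺ VecAllPairs.[]         = []
toList-unique⁺ (h VecAllPairs.∷ v!) = VecAll.toList⁺ h ∷ toList-unique⁺ v!

toList-unique⁻ : ∀ {m} {v : Vec A m} → Unique (toList v) → VecUnique.Unique v
toList-unique⁻ {v = []}    []         = VecAllPairs.[]
toList-unique⁻ {v = _ ∷ _} (h ∷ v!) = VecAll.toList⁻ h VecAllPairs.∷ toList-unique⁻ v!

perms-unique : ∀ n → Unique (perms n)
perms-unique n = Unique.filter⁺ (T? ∘ distinctᵇ ∘ toList) (allVecs-unique n (Unique.allFin⁺ n))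

∈-perms⁺ : ∀ {n} {π : Perm n} → VecUnique.Unique π → π ∈ perms n
∈-perms⁺ {n} π! = ∈-filter⁺ (T? ∘ distinctᵇ ∘ toList) (∈-allVecs ∈-allFin _)
  (unique⇒distinctᵇ (toList-unique⁺ π!))

∈-perms⁻ : ∀ {n} {π : Perm n} → π ∈ perms n → VecUnique.Unique π
∈-perms⁻ {n} {π} π∈ = toList-unique⁻
  (distinctᵇ⇒unique (toList π) (proj₂ (∈-filter⁻ (T? ∘ distinctᵇ ∘ toList) {xs = allVecs n (allFin n)} π∈)))

transpose-injective : ∀ {n} (i j : Fin n) {x y} → transpose i j x ≡ transpose i j y → x ≡ y
transpose-injective i j {x} {y} eq = begin
  x                                 ≡⟨ transpose-inverse j i ⟨
  transpose j i (transpose i j x)   ≡⟨ cong (transpose j i) eq ⟩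
  transpose j i (transpose i j y)   ≡⟨ transpose-inverse j i ⟩
  y                                 ∎
  where open ≡-Reasoning

transpose-left : ∀ {n} (i j : Fin n) → transpose i j i ≡ j
transpose-left i j rewrite dec-true (i Fin.≟ i) refl = refl

transpose-right : ∀ {n} (i j : Fin n) → transpose i j j ≡ i
transpose-right i j with j Fin.≟ i
... | yes j≡i = j≡i
... | no  _ rewrite dec-true (j Fin.≟ j) refl = refl

transpose-other : ∀ {n} (i j : Fin n) {k} → k ≢ i → k ≢ j → transpose i j k ≡ k
transpose-other i j {k} k≢i k≢j
  rewrite dec-false (k Fin.≟ i) k≢i | dec-false (k Fin.≟ j) k≢j = refl

-- Precomposition: `τ` acts on items, not on positions.
relabel : ∀ {n} → (Fin n → Fin n) → Perm n → Perm n
relabel τ π = Vec.tabulate (lookup π ∘ τ)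

relabel-transpose-injective : ∀ {n} (i j : Fin n) {π ρ} →
  relabel (transpose i j) π ≡ relabel (transpose i j) ρ → π ≡ ρ
relabel-transpose-injective i j {π} {ρ} eq = begin
  π                         ≡⟨ Vec.tabulate∘lookup π ⟨
  Vec.tabulate (lookup π)   ≡⟨ Vec.tabulate-cong pointwise ⟩
  Vec.tabulate (lookup ρ)   ≡⟨ Vec.tabulate∘lookup ρ ⟩
  ρ                         ∎
  where
  open ≡-Reasoning
  τ = transpose i j
  pointwise : ∀ x → lookup π x ≡ lookup ρ x
  pointwise x = begin
    lookup π x                               ≡⟨ cong (lookup π) (transpose-inverse i j) ⟨
    lookup π (τ (transpose j i x))           ≡⟨ Vec.lookup∘tabulate _ (transpose j i x) ⟨
    lookup (relabel τ π) (transpose j i x)   ≡⟨ cong (λ σ → lookup σ (transpose j i x)) eq ⟩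
    lookup (relabel τ ρ) (transpose j i x)   ≡⟨ Vec.lookup∘tabulate _ (transpose j i x) ⟩
    lookup ρ (τ (transpose j i x))           ≡⟨ cong (lookup ρ) (transpose-inverse i j) ⟩
    lookup ρ x                               ∎

ordered : ∀ {n} → List (Fin n) → Perm n → Bool
ordered ys π = increasingᵇ (map (lookup π) ys)

ordered-relabel : ∀ {n} (τ : Fin n → Fin n) π ys → ordered ys (relabel τ π) ≡ ordered (map τ ys) π
ordered-relabel τ π ys = cong increasingᵇ (trans (map-cong (Vec.lookup∘tabulate _) ys) (map-∘ ys))

#ordered : ∀ {n} → List (Fin n) → ℕ
#ordered {n} ys = count (ordered ys) (perms n)

unique-resp-↭ : ∀ {xs ys : List A} → xs ↭ ys → Unique xs → Unique ys
unique-resp-↭ {A = A} xs↭ys = Permₛ.Unique-resp-↭ (setoid A) (↭⇒↭ₛ xs↭ys)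

-- Uniqueness keeps `x` and `y` out of `as` and `bs`, where the transposition therefore acts
-- trivially.
map-transpose-adjacent : ∀ {n} (x y : Fin n) as bs → Unique (as ++ x ∷ y ∷ bs) →
  map (transpose x y) (as ++ x ∷ y ∷ bs) ≡ as ++ y ∷ x ∷ bs
map-transpose-adjacent x y []       bs ((x≢y ∷ x∉bs) ∷ y∉bs ∷ _)
  rewrite transpose-left x y | transpose-right x y
  = cong (λ l → y ∷ x ∷ l) (map-id-local
      (All.zipWith (λ (x≢b , y≢b) → transpose-other x y (≢-sym x≢b) (≢-sym y≢b)) (x∉bs , y∉bs)))
map-transpose-adjacent x y (a ∷ as) bs (a∉ ∷ rest) = cong₂ _∷_
  (transpose-other x y (All.lookup a∉ (∈-++⁺ʳ as (here refl)))
                       (All.lookup a∉ (∈-++⁺ʳ as (there (here refl)))))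
  (map-transpose-adjacent x y as bs rest)

-- Relabelling by `transpose x y` injects the permutations that order the swapped tuple into those
-- that order the original one.
#ordered-swap : ∀ {n} (x y : Fin n) as bs → Unique (as ++ x ∷ y ∷ bs) →
  #ordered (as ++ y ∷ x ∷ bs) ≤ #ordered (as ++ x ∷ y ∷ bs)
#ordered-swap {n} x y as bs ys! = count-injection _ _ (relabel τ)
  (relabel-transpose-injective x y) (perms-unique n) λ {π} π∈ inc →
    ∈-perms⁺ (VecUnique.tabulate⁺ (transpose-injective x y ∘ VecUnique.lookup-injective (∈-perms⁻ π∈) _ _)) ,
    subst T (trans (cong (λ l → ordered l π) (sym (map-transpose-adjacent x y as bs ys!)))
                   (sym (ordered-relabel τ π (as ++ x ∷ y ∷ bs)))) inc
  where τ = transpose x y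

insertions : A → List A → List (List A)
insertions x []       = [ [ x ] ]
insertions x (z ∷ zs) = (x ∷ z ∷ zs) ∷ map (z ∷_) (insertions x zs)

length-insertions : ∀ (x : A) zs → length (insertions x zs) ≡ suc (length zs)
length-insertions x []       = refl
length-insertions x (z ∷ zs) = cong suc (trans (length-map (z ∷_) (insertions x zs)) (length-insertions x zs))

-- An inserted `x` travels back to the front of its list by adjacent swaps. The prefix `as` collects
-- the items already passed, which the recursion needs.
#ordered-insertions : ∀ {n} as (x : Fin n) zs → Unique (as ++ x ∷ zs) →
  All (λ l → #ordered (as ++ l) ≤ #ordered (as ++ x ∷ zs)) (insertions x zs)
#ordered-insertions as x []       ys! = ≤-refl ∷ []
#ordered-insertions as x (z ∷ zs) ys! = ≤-refl ∷ All.map⁺ (All.map step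
  (#ordered-insertions (as ++ [ z ]) x zs (subst Unique (sym (++-assoc as [ z ] (x ∷ zs))) swapped!)))
  where
  swapped! : Unique (as ++ z ∷ x ∷ zs)
  swapped! = unique-resp-↭ (++⁺ˡ as (swap x z ↭-refl)) ys!
  step : ∀ {l} → #ordered ((as ++ [ z ]) ++ l) ≤ #ordered ((as ++ [ z ]) ++ x ∷ zs) →
    #ordered (as ++ z ∷ l) ≤ #ordered (as ++ x ∷ z ∷ zs)
  step {l} h = begin
    #ordered (as ++ z ∷ l)               ≡⟨ cong #ordered (++-assoc as [ z ] l) ⟨
    #ordered ((as ++ [ z ]) ++ l)        ≤⟨ h ⟩
    #ordered ((as ++ [ z ]) ++ x ∷ zs)   ≡⟨ cong #ordered (++-assoc as [ z ] (x ∷ zs)) ⟩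
    #ordered (as ++ z ∷ x ∷ zs)          ≤⟨ #ordered-swap x z as zs ys! ⟩
    #ordered (as ++ x ∷ z ∷ zs)          ∎
    where open ≤-Reasoning

module _ {n} (f : A → Fin n) where

  increasing : List A → Bool
  increasing zs = increasingᵇ (map f zs)

  increasing-∷ : ∀ {x y zs} → toℕ (f x) < toℕ (f y) → T (increasing (y ∷ zs)) → T (increasing (x ∷ y ∷ zs))
  increasing-∷ x<y inc = Equivalence.from T-∧ (<⇒<ᵇ x<y , inc)

  -- With the predecessor `z` known to lie below `x`, the search moves right until an item above `x`
  -- or the end is met. Carrying `z` along supplies the adjacent comparison that `increasingᵇ` makes
  -- across the insertion point.
  insert-above : ∀ x z zs → toℕ (f z) < toℕ (f x) → All (λ y → f x ≢ f y) zs → T (increasing (z ∷ zs)) →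
    Any (λ l → T (increasing (z ∷ l))) (insertions x zs)
  insert-above x z []       z<x []            inc = here (increasing-∷ {z} {x} {[]} z<x _)
  insert-above x z (y ∷ zs) z<x (x≢y ∷ fresh) inc with Equivalence.to T-∧ inc | <-cmp (toℕ (f x)) (toℕ (f y))
  ... | z<y , inc′ | tri< x<y _ _ = here (increasing-∷ {z} {x} {y ∷ zs} z<x (increasing-∷ {x} {y} {zs} x<y inc′))
  ... | z<y , inc′ | tri≈ _ x≡y _ = contradiction (Fin.toℕ-injective x≡y) x≢y
  ... | z<y , inc′ | tri> _ _ y<x = there (Any.map⁺
    (Any.map (λ {l} → increasing-∷ {z} {y} {l} (<ᵇ⇒< _ _ z<y)) (insert-above x y zs y<x fresh inc′)))

  insert-somewhere : ∀ x zs → All (λ y → f x ≢ f y) zs → T (increasing zs) →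
    Any (λ l → T (increasing l)) (insertions x zs)
  insert-somewhere x []       fresh         inc = here _
  insert-somewhere x (z ∷ zs) (x≢z ∷ fresh) inc with <-cmp (toℕ (f x)) (toℕ (f z))
  ... | tri< x<z _ _ = here (increasing-∷ {x} {z} {zs} x<z inc)
  ... | tri≈ _ x≡z _ = contradiction (Fin.toℕ-injective x≡z) x≢z
  ... | tri> _ _ z<x = there (Any.map⁺ (insert-above x z zs z<x fresh inc))

any⇒1≤∑ : ∀ (P : A → Bool) {xs} → Any (T ∘ P) xs → 1 ≤ ∑ (𝟙 ∘ P) xs
any⇒1≤∑ P {x ∷ xs} (here Px) with P x
... | true = s≤s z≤n
any⇒1≤∑ P {x ∷ xs} (there h) = ≤-trans (any⇒1≤∑ P h) (m≤n+m _ (𝟙 (P x)))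

-- Double counting: a permutation that orders `zs` orders some insertion of `x`, and by symmetry no
-- insertion is ordered more often than the one at the front.
#ordered-∷ : ∀ {n} (x : Fin n) zs → Unique (x ∷ zs) → #ordered zs ≤ suc (length zs) * #ordered (x ∷ zs)
#ordered-∷ {n} x zs ys!@(x∉zs ∷ _) = begin
  #ordered zs
    ≡⟨ count≡∑ (ordered zs) (perms n) ⟩
  ∑ (𝟙 ∘ ordered zs) (perms n)
    ≤⟨ ∑-mono (All.tabulate λ {π} → pointwise π) ⟩
  ∑ (λ π → ∑ (λ l → 𝟙 (ordered l π)) (insertions x zs)) (perms n)
    ≡⟨ ∑-swap (λ π l → 𝟙 (ordered l π)) (perms n) (insertions x zs) ⟩
  ∑ (λ l → ∑ (𝟙 ∘ ordered l) (perms n)) (insertions x zs)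
    ≡⟨ ∑-cong (λ l → count≡∑ (ordered l) (perms n)) (insertions x zs) ⟨
  ∑ #ordered (insertions x zs)
    ≤⟨ ∑-mono (#ordered-insertions [] x zs ys!) ⟩
  ∑ (λ _ → #ordered (x ∷ zs)) (insertions x zs)
    ≡⟨ ∑-const (#ordered (x ∷ zs)) (insertions x zs) ⟩
  length (insertions x zs) * #ordered (x ∷ zs)
    ≡⟨ cong (_* #ordered (x ∷ zs)) (length-insertions x zs) ⟩
  suc (length zs) * #ordered (x ∷ zs) ∎
  where
  open ≤-Reasoning
  pointwise : ∀ π → π ∈ perms n → 𝟙 (ordered zs π) ≤ ∑ (λ l → 𝟙 (ordered l π)) (insertions x zs)
  pointwise π π∈ with ordered zs π in eq
  ... | false = z≤n
  ... | true  = any⇒1≤∑ (λ l → ordered l π) (insert-somewhere (lookup π) x zs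
    (All.map (λ x≢z → x≢z ∘ VecUnique.lookup-injective (∈-perms⁻ π∈) _ _) x∉zs)
    (subst T (sym eq) _))

-- Every permutation orders the empty tuple, and adding items one at a time costs factors 1, 2, ...,
-- k. So a random permutation succeeds with probability at least 1/k!.
#perms≤ : ∀ {n} (ys : List (Fin n)) → Unique ys → length (perms n) ≤ factorial (length ys) * #ordered ys
#perms≤ {n} []       _ = ≤-reflexive (trans (sym (count-all (perms n))) (sym (+-identityʳ _)))
#perms≤ {n} (y ∷ ys) ys!@(_ ∷ tail!) = begin
  length (perms n)
    ≤⟨ #perms≤ ys tail! ⟩
  factorial (length ys) * #ordered ys
    ≤⟨ *-monoʳ-≤ (factorial (length ys)) (#ordered-∷ y ys ys!) ⟩
  factorial (length ys) * (suc (length ys) * #ordered (y ∷ ys))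
    ≡⟨ eq (factorial (length ys)) (suc (length ys)) _ ⟩
  suc (length ys) * factorial (length ys) * #ordered (y ∷ ys) ∎
  where
  open ≤-Reasoning
  eq : ∀ a b c → a * (b * c) ≡ b * a * c
  eq = solve-∀

-- The union bound over tuples

-- The mean weight falls as the success probability rises, so the bound 1/f on the latter bounds it
-- by 1 - (1-t)/f.
tilt-sum≤ : ∀ {n} (ys : List (Fin n)) p r → Unique ys →
  let f = factorial (length ys) in
  f * ∑ (tilt (den p r) (num p r) ∘ ordered ys) (perms n) ≤ length (perms n) * residue f p r
tilt-sum≤ {n} ys p r ys! = +-cancelʳ-≤ (M * u) _ _ (begin
  f * G + M * u                ≤⟨ +-monoʳ-≤ (f * G) (*-monoˡ-≤ u (#perms≤ ys ys!)) ⟩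
  f * G + f * #ordered ys * u  ≡⟨ cong (f * G +_) (*-assoc f (#ordered ys) u) ⟩
  f * G + f * (#ordered ys * u) ≡⟨ *-distribˡ-+ f G _ ⟨
  f * (G + #ordered ys * u)    ≡⟨ cong (f *_) total ⟩
  f * (M * den p r)            ≡⟨ eq f M (den p r) ⟩
  M * (f * den p r)            ≡⟨ cong (M *_) (residue+gap f p r {{factorial≢0 (length ys)}}) ⟨
  M * (residue f p r + u)      ≡⟨ *-distribˡ-+ M (residue f p r) u ⟩
  M * residue f p r + M * u    ∎)
  where
  open ≤-Reasoning
  f = factorial (length ys)
  M = length (perms n)
  u = gap p r
  G = ∑ (tilt (den p r) (num p r) ∘ ordered ys) (perms n)
  total : G + #ordered ys * u ≡ M * den p r
  total = subst (λ s → ∑ (tilt s (num p r) ∘ ordered ys) (perms n) + #ordered ys * u ≡ M * s)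
    (sym (den≡num+gap p r)) (∑-tilt (num p r) u (ordered ys) (perms n))
  eq : ∀ a b c → a * (b * c) ≡ b * (a * c)
  eq = solve-∀

-- The Chernoff bound, the bound on the mean weight and the tail estimate combine: for one tuple,
-- bad samples make up at most a fraction n^(-(k+1)).
#bad≤ : ∀ n ξ p r (ys : List (Fin n)) (P : Vec (Perm n) ξ → Bool) → 0 < p → Unique ys →
  let f = factorial (length ys) in
  LnLeq n (ξ * (p * p)) (2 * factorial (suc (length ys)) * ((p + r) * (p + r))) →
  (∀ S → T (P S) → count (ordered ys) (toList S) * (f * (p + r)) ≤ r * ξ) →
  n ^ suc (length ys) * count P (allVecs ξ (perms n)) ≤ length (perms n) ^ ξ
#bad≤ n ξ p r ys P 0<p ys! ln≤ few = *-cancelʳ-≤ _ _ (t ^ x * (f * s) ^ ξ) (begin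
  N * β * (t ^ x * (f * s) ^ ξ)         ≡⟨ cong (λ e → N * β * (t ^ x * e)) (^-distribʳ-* ξ f s) ⟩
  N * β * (t ^ x * (f ^ ξ * s ^ ξ))     ≡⟨ regroup N β (t ^ x) (f ^ ξ) (s ^ ξ) ⟩
  N * f ^ ξ * (β * (t ^ x * s ^ ξ))
    ≤⟨ *-monoʳ-≤ (N * f ^ ξ) (chernoff s t x (ordered ys) P (num≤den p r) few′ (perms n)) ⟩
  N * f ^ ξ * (G ^ ξ * s ^ x)           ≡⟨ regroup′ N (f ^ ξ) (G ^ ξ) (s ^ x) ⟩
  N * s ^ x * (f ^ ξ * G ^ ξ)           ≡⟨ cong (N * s ^ x *_) (^-distribʳ-* ξ f G) ⟨
  N * s ^ x * (f * G) ^ ξ               ≤⟨ *-monoʳ-≤ (N * s ^ x) (^-monoˡ-≤ ξ (tilt-sum≤ ys p r ys!)) ⟩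
  N * s ^ x * (M * w) ^ ξ               ≡⟨ cong (N * s ^ x *_) (^-distribʳ-* ξ M w) ⟩
  N * s ^ x * (M ^ ξ * w ^ ξ)           ≡⟨ regroup″ N (s ^ x) (M ^ ξ) (w ^ ξ) ⟩
  M ^ ξ * (N * (s ^ x * w ^ ξ))
    ≤⟨ *-monoʳ-≤ (M ^ ξ) (lnLeq⇒tail≤ n k ξ p r f x 0<p ln≤ (m/n*n≤m (r * ξ) (f * (p + r)))) ⟩
  M ^ ξ * (t ^ x * (f * s) ^ ξ)         ∎)
  where
  open ≤-Reasoning
  k = length ys
  f = factorial k
  s = den p r
  t = num p r
  w = residue f p r
  M = length (perms n)
  N = n ^ suc k
  β = count P (allVecs ξ (perms n))
  G = ∑ (tilt s t ∘ ordered ys) (perms n)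
  instance
    q≢0 : NonZero (p + r)
    q≢0 = >-nonZero (≤-trans 0<p (m≤m+n p r))
    s≢0 : NonZero s
    s≢0 = den≢0 p r 0<p
    t≢0 : NonZero t
    t≢0 = num≢0 p r 0<p
    f≢0 : NonZero f
    f≢0 = factorial≢0 k
    fq≢0 : NonZero (f * (p + r))
    fq≢0 = m*n≢0 f (p + r)
    fs≢0 : NonZero (f * s)
    fs≢0 = m*n≢0 f s
  -- This is ⌊(1-δ)ξ/k!⌋; rounding down loses nothing, because the number of successes is an
  -- integer.
  x = r * ξ / (f * (p + r))
  instance
    cancelled≢0 : NonZero (t ^ x * (f * s) ^ ξ)
    cancelled≢0 = m*n≢0 (t ^ x) ((f * s) ^ ξ) {{m^n≢0 t x}} {{m^n≢0 (f * s) ξ}}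
  few′ : ∀ S → T (P S) → count (ordered ys) (toList S) ≤ x
  few′ S PS = subst (_≤ x) (m*n/n≡m _ (f * (p + r))) (/-monoˡ-≤ (f * (p + r)) (few S PS))
  regroup : ∀ a b c d e → a * b * (c * (d * e)) ≡ a * d * (b * (c * e))
  regroup = solve-∀
  regroup′ : ∀ a b c d → a * b * (c * d) ≡ a * d * (b * c)
  regroup′ = solve-∀
  regroup″ : ∀ a b c d → a * b * (c * d) ≡ c * (a * (b * d))
  regroup″ = solve-∀

length-distinctTuples : ∀ n k → length (distinctTuples n k) ≤ n ^ k
length-distinctTuples n k = begin
  length (distinctTuples n k)      ≤⟨ length-filter (T? ∘ distinctᵇ ∘ toList) (allVecs k (allFin n)) ⟩
  length (allVecs k (allFin n))    ≡⟨ length-allVecs k (allFin n) ⟩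
  length (allFin n) ^ k            ≡⟨ cong (_^ k) (length-tabulate {n = n} id) ⟩
  n ^ k                            ∎
  where open ≤-Reasoning

distinctTuples-unique : ∀ n k → All (Unique ∘ toList) (distinctTuples n k)
distinctTuples-unique n k = All.map (λ {v} → distinctᵇ⇒unique (toList v))
  (All.all-filter (T? ∘ distinctᵇ ∘ toList) (allVecs k (allFin n)))

mainTheorem7 : (n k ξ p q : ℕ) → 1 ≤ k → k ≤ n → 0 < p → p < q
    → LnLeq n (ξ * (p * p)) (2 * factorial (suc k) * (q * q))
    → (n ∸ 1) * allSamples n ξ ≤ n * goodSamples n k p q ξ
-- The truncated `0 ∸ 1` makes the left side 0.
mainTheorem7 zero        k ξ p q _ _ _ _ _ = z≤n
mainTheorem7 n@(suc n-1) k ξ p q _ _ 0<p p<q ln≤ with m≤n⇒∃[o]m+o≡n (<⇒≤ p<q)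
-- With q = p + r, the target fraction 1 - δ is r/q. Adding `all#` to both sides replaces the
-- subtraction of 1/n.
... | r , refl = +-cancelʳ-≤ all# _ _ (begin
  n-1 * all# + all#                                ≡⟨ +-comm (n-1 * all#) all# ⟩
  n * all#                                         ≤⟨ *-monoʳ-≤ n (union-bound R samples tuples) ⟩
  n * (goodSamples n k p (p + r) ξ + ∑ bad tuples) ≡⟨ *-distribˡ-+ n (goodSamples n k p (p + r) ξ) _ ⟩
  n * goodSamples n k p (p + r) ξ + n * ∑ bad tuples
    ≤⟨ +-monoʳ-≤ (n * goodSamples n k p (p + r) ξ) n*∑bad≤ ⟩
  n * goodSamples n k p (p + r) ξ + all#           ∎)
  where
  open ≤-Reasoning
  all#    = allSamples n ξ
  samples = allVecs ξ (perms n)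
  tuples  = distinctTuples n k

  R : Vec (Perm n) ξ → Vec (Fin n) k → Bool
  R S ys = ⌊ (p + r ∸ p) * ξ ≤? count (ordered (toList ys)) (toList S) * factorial k * (p + r) ⌋

  bad : Vec (Fin n) k → ℕ
  bad ys = count (λ S → not (R S ys)) samples

  few : ∀ ys S → T (not (R S ys)) → count (ordered (toList ys)) (toList S) * (factorial k * (p + r)) ≤ r * ξ
  few ys S h with (p + r ∸ p) * ξ ≤? count (ordered (toList ys)) (toList S) * factorial k * (p + r)
  ... | no ≰ = begin
    X * (factorial k * (p + r))   ≡⟨ *-assoc X (factorial k) (p + r) ⟨
    X * factorial k * (p + r)     ≤⟨ <⇒≤ (≰⇒> ≰) ⟩
    (p + r ∸ p) * ξ               ≡⟨ cong (_* ξ) (m+n∸m≡n p r) ⟩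
    r * ξ                         ∎
    where X = count (ordered (toList ys)) (toList S)

  bad≤ : ∀ ys → Unique (toList ys) → n ^ suc k * bad ys ≤ all#
  bad≤ ys ys! = begin
    n ^ suc k * bad ys      ≤⟨ bound k (Vec.length-toList ys) ln≤ (few ys) ⟩
    length (perms n) ^ ξ    ≡⟨ length-allVecs ξ (perms n) ⟨
    all#                    ∎
    where
    -- The length of `toList ys` is `k` only propositionally; generalising `k` to `l` lets `refl`
    -- identify them.
    bound : ∀ l → length (toList ys) ≡ l →
      LnLeq n (ξ * (p * p)) (2 * factorial (suc l) * ((p + r) * (p + r))) →
      (∀ S → T (not (R S ys)) → count (ordered (toList ys)) (toList S) * (factorial l * (p + r)) ≤ r * ξ) →
      n ^ suc l * bad ys ≤ length (perms n) ^ ξ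
    bound _ refl = #bad≤ n ξ p r (toList ys) (λ S → not (R S ys)) 0<p ys!

  n*∑bad≤ : n * ∑ bad tuples ≤ all#
  -- The factor n^k brings each summand into the form bounded by `bad≤`, and it is also the bound on
  -- the number of tuples, so it cancels.
  n*∑bad≤ = *-cancelˡ-≤ (n ^ k) {{m^n≢0 n k}} (begin
    n ^ k * (n * ∑ bad tuples)           ≡⟨ eq (n ^ k) n (∑ bad tuples) ⟩
    n ^ suc k * ∑ bad tuples             ≡⟨ ∑-*ˡ (n ^ suc k) bad tuples ⟨
    ∑ (λ ys → n ^ suc k * bad ys) tuples ≤⟨ ∑-mono (All.map (λ {ys} → bad≤ ys) (distinctTuples-unique n k)) ⟩
    ∑ (λ _ → all#) tuples                ≡⟨ ∑-const all# tuples ⟩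
    length tuples * all#                 ≤⟨ *-monoˡ-≤ all# (length-distinctTuples n k) ⟩
    n ^ k * all#                         ∎)
    where
    eq : ∀ a b c → a * (b * c) ≡ b * a * c
    eq = solve-∀
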